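{- Let $\tilde{G}=(\tilde{Q},\tilde{E},\tilde{\delta},\tilde{q}_0)$ be a fuzzy discrete event system with uncontrollability degrees $\tilde{E}_{uc}:\tilde{E}\to[0,1]$. For $\tilde{q}\in\tilde{Q}$ let $S_{\tilde{G}}(\tilde{q})=\{\tilde{s}\in\tilde{E}^*:\tilde{\delta}(\tilde{q}_0,\tilde{s})=\tilde{q}\}$, let $$\chi(\tilde{q})=\bigwedge\{\tilde{E}_{uc}(\tilde{a}):\tilde{a}\in\tilde{E},\ \exists\,\tilde{s}\in S_{\tilde{G}}(\tilde{q}),\ \tilde{w},\tilde{u}\in\tilde{E}^*\text{ such that }\tilde{s}=\tilde{w}\tilde{a}\tilde{u}\}$$ (with $\bigwedge\emptyset=1$), and let $$\mathscr{R}(\tilde{q})=\{\alpha\cdot\tilde{q}:\chi(\tilde{q})\le\alpha\le1\}\cap\tilde{Q}.$$ Let $R(\tilde{G})$ be the set of fuzzy states reachable in $\tilde{G}$ and let $\mathscr{R}(\tilde{G})$ be the set of all $\tilde{q}\in\tilde{Q}$ for which there is a fuzzy state feedback controller $f$ for $\tilde{G}$ with $\tilde{q}\in R(\tilde{G}^f)$. Then $$\mathscr{R}(\tilde{G})=\bigcup_{\tilde{q}\in R(\tilde{G})}\mathscr{R}(\tilde{q}).$$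
   Context: Notation: $\wedge,\vee$ denote infimum (minimum) and supremum (maximum) in $[0,1]$. Fix $n\ge1$. $\tilde{Q}$ is the set of fuzzy states: all row vectors in $[0,1]^n$ other than the zero vector. A fuzzy event is an $n\times n$ matrix over $[0,1]$; $\tilde{E}$ is a finite set of fuzzy events; $\tilde{q}_0\in\tilde{Q}$ is the initial state. $\tilde{E}^*$ is the set of finite strings over $\tilde{E}$, with empty string $\epsilon$. The max-min composition is $(A\circ B)_{ij}=\bigvee_l(a_{il}\wedge b_{lj})$. For $\lambda\in[0,1]$ and a vector $x$, $\lambda\cdot x$ is the vector with entries $\lambda\wedge x_i$. The (partial) transition function is $\tilde{\delta}(\tilde{q},\tilde{a})=\tilde{q}\circ\tilde{a}$, regarded as undefined when $\tilde{q}\circ\tilde{a}$ is the zero vector; it is extended to strings by $\tilde{\delta}(\tilde{q},\epsilon)=\tilde{q}$, $\tilde{\delta}(\tilde{q},\tilde{s}\tilde{a})=\tilde{\delta}(\tilde{\delta}(\tilde{q},\tilde{s}),\tilde{a})$. Each $\tilde{a}\in\tilde{E}$ has an uncontrollability degree $\tilde{E}_{uc}(\tilde{a})\in[0,1]$. A fuzzy state feedback controller (FSFC) for $\tilde{G}$ is a map $f$ assigning to each $\tilde{q}\in\tilde{Q}$ a function $f(\tilde{q}):\tilde{E}\to[0,1]$ with $f(\tilde{q})(\tilde{a})\ge\tilde{E}_{uc}(\tilde{a})$ for all $\tilde{q},\tilde{a}$. The closed-loop system is $\tilde{G}^f=(\tilde{Q},\tilde{E},\tilde{\delta}^f,\tilde{q}_0)$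 with $\tilde{\delta}^f(\tilde{q},\tilde{a})=f(\tilde{q})(\tilde{a})\cdot(\tilde{q}\circ\tilde{a})$, undefined when this is the zero vector, and extended to strings in the same way as $\tilde{\delta}$. $R(\tilde{G})$ (resp. $R(\tilde{G}^f)$) is the set of $\tilde{q}\in\tilde{Q}$ with $\tilde{q}=\tilde{\delta}(\tilde{q}_0,\tilde{s})$ (resp. $\tilde{q}=\tilde{\delta}^f(\tilde{q}_0,\tilde{s})$) for some $\tilde{s}\in\tilde{E}^*$. -}

module Defs where

open import Data.Empty using (⊥)
open import Data.Fin.Base using (Fin)
open import Data.List.Base using (List; []; _∷_; _++_; _∷ʳ_)
open import Data.Nat.Base using (ℕ)
open import Data.Product.Base using (Σ; Σ-syntax; ∃; ∃-syntax; _×_; _,_; proj₁; proj₂)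
open import Data.Rational.Base using (ℚ; 0ℚ; 1ℚ) renaming (_<_ to _<ℚ_; _+_ to _+ℚ_; _-_ to _-ℚ_)
import Data.Rational.Properties as ℚ
open import Data.Sum.Base using (_⊎_; inj₁; inj₂; [_,_]′)
import Data.Sum.Base as Sum
open import Data.Vec.Functional using (Vector; foldr)
open import Function.Definitions using (Injective)
open import Level using (0ℓ; suc)
open import Relation.Binary.Core using (Rel)
open import Relation.Binary.Definitions using (tri<; tri≈; tri>)
open import Relation.Binary.Lattice.Bundles using (BoundedLattice)
open import Relation.Binary.PropositionalEquality.Core using (_≡_; refl)
open import Relation.Nullary.Negation.Core using (¬_)
open import Relation.Unary using (Pred; _∈_)

-- Real numbers as two-sided Dedekind cuts.

record ℝ : Set₁ where
  field
    L U         : Pred ℚ 0ℓ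
    L-inhabited : ∃ L
    U-inhabited : ∃ U
    L-lower     : ∀ {p q} → p <ℚ q → L q → L p
    U-upper     : ∀ {p q} → p <ℚ q → U p → U q
    L-open      : ∀ {p} → L p → ∃[ q ] p <ℚ q × L q
    U-open      : ∀ {q} → U q → ∃[ p ] p <ℚ q × U p
    disjoint    : ∀ {q} → L q → U q → ⊥
    located     : ∀ {p q} → p <ℚ q → L p ⊎ U q

open ℝ

infix 4 _≤ᴿ_
infixr 7 _⊓_
infixr 6 _⊔_

_≤ᴿ_ : Rel ℝ 0ℓ
x ≤ᴿ y = ∀ q → L x q → L y q

private
  below : ∀ q → ∃[ p ] p <ℚ q
  below q = q -ℚ 1ℚ , ℚ.<-respʳ-≡ (ℚ.+-identityʳ q) (ℚ.+-monoʳ-< q (ℚ.negative⁻¹ _))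

  above : ∀ q → ∃[ p ] q <ℚ p
  above q = q +ℚ 1ℚ , ℚ.<-respˡ-≡ (ℚ.+-identityʳ q) (ℚ.+-monoʳ-< q (ℚ.positive⁻¹ _))

  ℚ-located : ∀ r {p q} → p <ℚ q → p <ℚ r ⊎ r <ℚ q
  ℚ-located r {p} {q} p<q with ℚ.<-cmp p r
  ... | tri< p<r _ _    = inj₁ p<r
  ... | tri≈ _ refl _   = inj₂ p<q
  ... | tri> _ _ r<p    = inj₂ (ℚ.<-trans r<p p<q)

fromℚ : ℚ → ℝ
fromℚ r = record
  { L           = λ q → q <ℚ r
  ; U           = λ q → r <ℚ q
  ; L-inhabited = below r
  ; U-inhabited = above r
  ; L-lower     = ℚ.<-trans
  ; U-upper     = λ p<q r<p → ℚ.<-trans r<p p<q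
  ; L-open      = λ p<r → let (m , p<m , m<r) = ℚ.<-dense p<r in m , p<m , m<r
  ; U-open      = λ r<q → let (m , r<m , m<q) = ℚ.<-dense r<q in m , m<q , r<m
  ; disjoint    = ℚ.<-asym
  ; located     = ℚ-located r
  }

private
  L-both : ∀ (x y : ℝ) {p q} → L x p → L y q → ∃[ r ] L x r × L y r × (r ≡ p ⊎ r ≡ q)
  L-both x y {p} {q} xp yq with ℚ.<-cmp p q
  ... | tri< p<q _ _  = p , xp , L-lower y p<q yq , inj₁ refl
  ... | tri≈ _ refl _ = p , xp , yq , inj₁ refl
  ... | tri> _ _ q<p  = q , L-lower x q<p xp , yq , inj₂ refl

  U-both : ∀ (x y : ℝ) {p q} → U x p → U y q → ∃[ r ] U x r × U y r × (r ≡ p ⊎ r ≡ q)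
  U-both x y {p} {q} xp yq with ℚ.<-cmp p q
  ... | tri< p<q _ _  = q , U-upper x p<q xp , yq , inj₂ refl
  ... | tri≈ _ refl _ = p , xp , yq , inj₁ refl
  ... | tri> _ _ q<p  = p , xp , U-upper y q<p yq , inj₁ refl

_⊓_ : ℝ → ℝ → ℝ
x ⊓ y = record
  { L           = λ q → L x q × L y q
  ; U           = λ q → U x q ⊎ U y q
  ; L-inhabited = let (_ , xp) = L-inhabited x ; (_ , yq) = L-inhabited y
                      (r , xr , yr , _) = L-both x y xp yq
                  in r , xr , yr
  ; U-inhabited = let (p , xp) = U-inhabited x in p , inj₁ xp
  ; L-lower     = λ p<q (xq , yq) → L-lower x p<q xq , L-lower y p<q yq
  ; U-upper     = λ p<q → Sum.map (U-upper x p<q) (U-upper y p<q)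
  ; L-open      = λ (xp , yp) → open-L xp yp
  ; U-open      = [ (λ xq → let (p , p<q , xp) = U-open x xq in p , p<q , inj₁ xp)
                  , (λ yq → let (p , p<q , yp) = U-open y yq in p , p<q , inj₂ yp) ]′
  ; disjoint    = λ (xq , yq) → [ disjoint x xq , disjoint y yq ]′
  ; located     = λ p<q → loc (located x p<q) (located y p<q)
  }
  where
  open-L : ∀ {p} → L x p → L y p → ∃[ q ] p <ℚ q × L x q × L y q
  open-L xp yp with L-open x xp | L-open y yp
  ... | q , p<q , xq | r , p<r , yr with L-both x y xq yr
  ... | s , xs , ys , inj₁ refl = s , p<q , xs , ys
  ... | s , xs , ys , inj₂ refl = s , p<r , xs , ys

  loc : ∀ {p q} → L x p ⊎ U x q → L y p ⊎ U y q → (L x p × L y p) ⊎ (U x q ⊎ U y q)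
  loc (inj₁ xp) (inj₁ yp) = inj₁ (xp , yp)
  loc (inj₁ _)  (inj₂ yq) = inj₂ (inj₂ yq)
  loc (inj₂ xq) _         = inj₂ (inj₁ xq)

_⊔_ : ℝ → ℝ → ℝ
x ⊔ y = record
  { L           = λ q → L x q ⊎ L y q
  ; U           = λ q → U x q × U y q
  ; L-inhabited = let (p , xp) = L-inhabited x in p , inj₁ xp
  ; U-inhabited = let (_ , xp) = U-inhabited x ; (_ , yq) = U-inhabited y
                      (r , xr , yr , _) = U-both x y xp yq
                  in r , xr , yr
  ; L-lower     = λ p<q → Sum.map (L-lower x p<q) (L-lower y p<q)
  ; U-upper     = λ p<q (xp , yp) → U-upper x p<q xp , U-upper y p<q yp
  ; L-open      = [ (λ xp → let (q , p<q , xq) = L-open x xp in q , p<q , inj₁ xq)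
                  , (λ yp → let (q , p<q , yq) = L-open y yp in q , p<q , inj₂ yq) ]′
  ; U-open      = λ (xq , yq) → open-U xq yq
  ; disjoint    = λ xy (xq , yq) → [ (λ l → disjoint x l xq) , (λ l → disjoint y l yq) ]′ xy
  ; located     = λ p<q → loc (located x p<q) (located y p<q)
  }
  where
  open-U : ∀ {q} → U x q → U y q → ∃[ p ] p <ℚ q × U x p × U y p
  open-U xq yq with U-open x xq | U-open y yq
  ... | p , p<q , xp | r , r<q , yr with U-both x y xp yr
  ... | s , xs , ys , inj₁ refl = s , p<q , xs , ys
  ... | s , xs , ys , inj₂ refl = s , r<q , xs , ys

  loc : ∀ {p q} → L x p ⊎ U x q → L y p ⊎ U y q → (L x p ⊎ L y p) ⊎ (U x q × U y q)
  loc (inj₁ xp) _         = inj₁ (inj₁ xp)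
  loc (inj₂ _)  (inj₁ yp) = inj₁ (inj₂ yp)
  loc (inj₂ xq) (inj₂ yq) = inj₂ (xq , yq)

unitInterval : BoundedLattice (suc 0ℓ) 0ℓ 0ℓ
unitInterval = record
  { Carrier = Σ[ x ∈ ℝ ] fromℚ 0ℚ ≤ᴿ x × x ≤ᴿ fromℚ 1ℚ
  ; _≈_     = λ (x , _) (y , _) → x ≤ᴿ y × y ≤ᴿ x
  ; _≤_     = λ (x , _) (y , _) → x ≤ᴿ y
  ; _∨_     = λ (x , 0≤x , x≤1) (y , _ , y≤1) →
                x ⊔ y , (λ q l → inj₁ (0≤x q l)) , (λ q → [ x≤1 q , y≤1 q ]′)
  ; _∧_     = λ (x , 0≤x , x≤1) (y , 0≤y , _) →
                x ⊓ y , (λ q l → 0≤x q l , 0≤y q l) , (λ q (l , _) → x≤1 q l)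
  ; ⊤       = fromℚ 1ℚ , (λ q q<0 → ℚ.<-trans q<0 (ℚ.positive⁻¹ 1ℚ)) , (λ q l → l)
  ; ⊥       = fromℚ 0ℚ , (λ q l → l) , (λ q q<0 → ℚ.<-trans q<0 (ℚ.positive⁻¹ 1ℚ))
  ; isBoundedLattice = record
    { isLattice = record
      { isPartialOrder = record
        { isPreorder = record
          { isEquivalence = record
            { refl  = (λ q l → l) , (λ q l → l)
            ; sym   = λ (x≤y , y≤x) → y≤x , x≤y
            ; trans = λ (x≤y , y≤x) (y≤z , z≤y) →
                        (λ q l → y≤z q (x≤y q l)) , (λ q l → y≤x q (z≤y q l))
            }
          ; reflexive = proj₁
          ; trans     = λ x≤y y≤z q l → y≤z q (x≤y q l)
          }
        ; antisym = _,_
        }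
      ; supremum = λ _ _ → (λ q → inj₁) , (λ q → inj₂) , λ _ x≤z y≤z q → [ x≤z q , y≤z q ]′
      ; infimum  = λ _ _ → (λ q → proj₁) , (λ q → proj₂) , λ _ z≤x z≤y q l → z≤x q l , z≤y q l
      }
    ; maximum = λ (_ , _ , x≤1) → x≤1
    ; minimum = λ (_ , 0≤x , _) → 0≤x
    }
  }

open BoundedLattice unitInterval public
  using (_≈_; _≤_; _∨_; _∧_)
  renaming (Carrier to 𝕀; ⊥ to 𝟘; ⊤ to 𝟙)

⋁ : ∀ {n} → Vector 𝕀 n → 𝕀
⋁ = foldr _∨_ 𝟘

-- c is the greatest lower bound in [0,1] of the set P; for P = ∅ this says c ≈ 𝟙.
IsInfimum : Pred 𝕀 (suc 0ℓ) → Pred 𝕀 (suc 0ℓ)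
IsInfimum P c = (∀ x → x ∈ P → c ≤ x) × (∀ b → (∀ x → x ∈ P → b ≤ x) → b ≤ c)

Matrix : ℕ → Set₁
Matrix n = Fin n → Fin n → 𝕀

infix 4 _≈ⱽ_ _≈ᴹ_
infixl 8 _∘_
infixr 7 _·_

_≈ⱽ_ : ∀ {n} → Rel (Vector 𝕀 n) 0ℓ
v ≈ⱽ w = ∀ i → v i ≈ w i

_≈ᴹ_ : ∀ {n} → Rel (Matrix n) 0ℓ
A ≈ᴹ B = ∀ i j → A i j ≈ B i j

_∘_ : ∀ {n} → Vector 𝕀 n → Matrix n → Vector 𝕀 n
(v ∘ A) j = ⋁ (λ l → v l ∧ A l j)

_·_ : ∀ {n} → 𝕀 → Vector 𝕀 n → Vector 𝕀 n
(α · v) i = α ∧ v i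

State : ℕ → Set₁
State n = Σ[ v ∈ Vector 𝕀 n ] ¬ (v ≈ⱽ (λ _ → 𝟘))

vec : ∀ {n} → State n → Vector 𝕀 n
vec = proj₁

-- The finite set of events is given by an enumeration without repetition.
record FDES (n : ℕ) : Set₁ where
  field
    size      : ℕ
    matrix    : Fin size → Matrix n
    injective : Injective _≡_ _≈ᴹ_ matrix
    q₀        : State n

  Event : Set
  Event = Fin size

-- A partial map State × Event ⇀ State is represented by its graph: δ q a p says
-- that the value at (q , a) is defined and equal to p.
Transition : ℕ → Set → Set₁
Transition n E = State n → E → State n → Set

-- Extension of a partial transition map to strings, again as a graph.
data Extend {n : ℕ} {E : Set} (δ : Transition n E) :
            State n → List E → State n → Set₁ where
  empty : ∀ {q p} → vec q ≈ⱽ vec p → Extend δ q [] p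
  snoc  : ∀ {q r p s a} → Extend δ q s r → δ r a p → Extend δ q (s ∷ʳ a) p

-- States are nonzero, so no p satisfies the equation when the right-hand side
-- is the zero vector.
transition : ∀ {n} (G : FDES n) → Transition n (FDES.Event G)
transition G q a p = vec p ≈ⱽ vec q ∘ FDES.matrix G a

Reachable : ∀ {n} (G : FDES n) → Transition n (FDES.Event G) → Pred (State n) (suc 0ℓ)
Reachable G δ q = ∃[ s ] Extend δ (FDES.q₀ G) s q

record FSFC {n : ℕ} (G : FDES n) (Euc : FDES.Event G → 𝕀) : Set₁ where
  open FDES G
  field
    control    : State n → Event → 𝕀
    cong       : ∀ {q p} → vec q ≈ⱽ vec p → ∀ a → control q a ≈ control p a
    admissible : ∀ q a → Euc a ≤ control q a

closedLoop : ∀ {n} (G : FDES n) {Euc : FDES.Event G → 𝕀} → FSFC G Euc → Transition n (FDES.Event G)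
closedLoop G f q a p = vec p ≈ⱽ FSFC.control f q a · (vec q ∘ FDES.matrix G a)

module _ {n : ℕ} (G : FDES n) (Euc : FDES.Event G → 𝕀) where
  open FDES G

  S : State n → Pred (List Event) (suc 0ℓ)
  S q s = Extend (transition G) q₀ s q

  Occurs : State n → Pred Event (suc 0ℓ)
  Occurs q a = ∃[ s ] s ∈ S q × ∃[ w ] ∃[ u ] s ≡ w ++ a ∷ u

  -- χ(q) as a predicate: its elements are exactly the representatives, up to ≈, of the infimum.
  χ : State n → Pred 𝕀 (suc 0ℓ)
  χ q = IsInfimum (λ x → ∃[ a ] Occurs q a × x ≈ Euc a)

  ℛ : State n → Pred (State n) (suc 0ℓ)
  ℛ q p = ∃[ c ] c ∈ χ q × ∃[ α ] c ≤ α × α ≤ 𝟙 × vec p ≈ⱽ α · vec q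

  ControlReachable : Pred (State n) (suc 0ℓ)
  ControlReachable p = ∃[ f ] p ∈ Reachable G (closedLoop G {Euc} f)

-- The action of scalars commutes with the max-min composition, so along any run
-- of the closed loop the state is β · q, where q is the state of the open loop
-- after the same string and β is the meet of the controls that were applied.
-- Every control is at least the uncontrollability degree of its event, hence
-- β ≥ χ(q).
-- Conversely, [0,1] being a chain, χ(q) is either 1 or the degree of an event on
-- some string s leading to q. For α ≥ χ(q), the state-independent controller
-- a ↦ α ∨ Ẽuc(a) then applies controls whose meet along s is exactly α.

module Submission where

import Algebra.Definitions as Definitions
open import Axiom.ExcludedMiddle using (ExcludedMiddle)
open import Data.Fin.Base using (Fin)
open import Data.List.Base using (List; allFin; filter; map)
import Data.List.Extrema as Extrema
open import Data.List.Membership.Propositional using () renaming (_∈_ to _∈ˡ_)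
open import Data.List.Membership.Propositional.Properties
  using (∈-∃++; ∈-allFin; ∈-filter⁺; ∈-filter⁻; ∈-insert; ∈-map⁺; ∈-map⁻)
open import Data.List.Relation.Unary.All as All using (All; [])
open import Data.List.Relation.Unary.All.Properties using (∷ʳ⁺; ∷ʳ⁻)
open import Data.Nat.Base using (ℕ; NonZero)
import Data.Nat.Base as ℕ
open import Data.Product.Base using (Σ-syntax; ∃-syntax; _×_; _,_; proj₁; proj₂)
import Data.Rational.Properties as ℚ
import Data.Sum.Base as Sum
open import Data.Sum.Base using (_⊎_; inj₁; inj₂; [_,_]′)
open import Data.Vec.Functional using (Vector; foldr; head; tail)
import Data.Vec.Functional.Relation.Binary.Equality.Setoid as VectorEquality
open import Level using (Lift; 0ℓ; suc; lift; lower)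
open import Relation.Binary.Bundles using (TotalOrder)
open import Relation.Binary.Definitions using (Total; tri<; tri≈; tri>)
open import Relation.Binary.Lattice.Bundles using (BoundedLattice)
import Relation.Binary.Lattice.Properties.BoundedLattice as BoundedLatticeProperties
import Relation.Binary.Lattice.Properties.JoinSemilattice as JoinProperties
import Relation.Binary.Lattice.Properties.MeetSemilattice as MeetProperties
open import Relation.Binary.PropositionalEquality.Core using (_≡_; refl)
import Relation.Binary.Reasoning.Setoid as SetoidReasoning
open import Relation.Nullary.Decidable.Core using (Dec; yes; no; map′; decidable-stable)
open import Relation.Nullary.Negation.Core using (¬_; contradiction)
open import Relation.Unary using (Decidable; _∈_; _≐_; ⋃)

-- Max-min algebra of vectors over a distributive bounded lattice.

module VectorAlgebra {c ℓ₁ ℓ₂} (𝓛 : BoundedLattice c ℓ₁ ℓ₂)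
  (∧-distribˡ-∨ : Definitions._DistributesOverˡ_ (BoundedLattice._≈_ 𝓛)
                    (BoundedLattice._∧_ 𝓛) (BoundedLattice._∨_ 𝓛))
  where

  open BoundedLattice 𝓛
    using (Carrier; _≈_; _∨_; _∧_; ⊤; ⊥; maximum; module Eq; setoid; joinSemilattice; meetSemilattice)
  open BoundedLatticeProperties 𝓛 using (∧-zeroˡ; ∧-zeroʳ)
  open JoinProperties joinSemilattice using (∨-cong)
  open MeetProperties meetSemilattice using (∧-assoc; ∧-cong; y≤x⇒x∧y≈y)
  open VectorEquality setoid using (_≋_; ≋-setoid; foldr-cong)

  private
    variable
      m n : ℕ

  infixr 7 _·ⱽ_
  infixl 8 _∘ⱽ_

  ⋁ⱽ : Vector Carrier m → Carrier
  ⋁ⱽ = foldr _∨_ ⊥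

  _·ⱽ_ : Carrier → Vector Carrier n → Vector Carrier n
  (α ·ⱽ v) i = α ∧ v i

  _∘ⱽ_ : Vector Carrier n → (Fin n → Fin n → Carrier) → Vector Carrier n
  (v ∘ⱽ A) j = ⋁ⱽ (λ l → v l ∧ A l j)

  𝟎 : Vector Carrier n
  𝟎 _ = ⊥

  ∧-distribˡ-⋁ : ∀ α (v : Vector Carrier m) → α ∧ ⋁ⱽ v ≈ ⋁ⱽ (α ·ⱽ v)
  ∧-distribˡ-⋁ {m = ℕ.zero}  α v = ∧-zeroʳ α
  ∧-distribˡ-⋁ {m = ℕ.suc _} α v = begin
    α ∧ (head v ∨ ⋁ⱽ (tail v))             ≈⟨ ∧-distribˡ-∨ α (head v) (⋁ⱽ (tail v)) ⟩
    (α ∧ head v) ∨ (α ∧ ⋁ⱽ (tail v))       ≈⟨ ∨-cong Eq.refl (∧-distribˡ-⋁ α (tail v)) ⟩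
    (α ∧ head v) ∨ ⋁ⱽ (α ·ⱽ tail v)        ∎
    where open SetoidReasoning setoid

  ∘-congʳ : (v w : Vector Carrier n) (A : Fin n → Fin n → Carrier) → v ≋ w → v ∘ⱽ A ≋ w ∘ⱽ A
  ∘-congʳ v w A v≋w j = foldr-cong ∨-cong Eq.refl (λ l → ∧-cong (v≋w l) Eq.refl)

  ·-congˡ : ∀ α (v w : Vector Carrier n) → v ≋ w → α ·ⱽ v ≋ α ·ⱽ w
  ·-congˡ α v w v≋w i = ∧-cong Eq.refl (v≋w i)

  ·-congʳ : ∀ α β (v : Vector Carrier n) → α ≈ β → α ·ⱽ v ≋ β ·ⱽ v
  ·-congʳ α β v α≈β i = ∧-cong α≈β Eq.refl

  ·-identityˡ : (v : Vector Carrier n) → ⊤ ·ⱽ v ≋ v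
  ·-identityˡ v i = y≤x⇒x∧y≈y (maximum (v i))

  ·-∘-assoc : ∀ α (v : Vector Carrier n) A → (α ·ⱽ v) ∘ⱽ A ≋ α ·ⱽ (v ∘ⱽ A)
  ·-∘-assoc α v A j = begin
    ⋁ⱽ (λ l → (α ∧ v l) ∧ A l j)    ≈⟨ foldr-cong ∨-cong Eq.refl (λ l → ∧-assoc α (v l) (A l j)) ⟩
    ⋁ⱽ (λ l → α ∧ (v l ∧ A l j))    ≈⟨ ∧-distribˡ-⋁ α (λ l → v l ∧ A l j) ⟨
    α ∧ ⋁ⱽ (λ l → v l ∧ A l j)      ∎
    where open SetoidReasoning setoid

  ∘-preserves-𝟎 : (v : Vector Carrier n) (A : Fin n → Fin n → Carrier) → v ≋ 𝟎 → v ∘ⱽ A ≋ 𝟎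
  ∘-preserves-𝟎 v A v≋𝟎 j = begin
    ⋁ⱽ (λ l → v l ∧ A l j)    ≈⟨ ∘-congʳ v 𝟎 A v≋𝟎 j ⟩
    -- Distributivity read backwards with the scalar `⊥` collapses the join without an induction on
    -- its length.
    ⋁ⱽ (λ l → ⊥ ∧ A l j)      ≈⟨ ∧-distribˡ-⋁ ⊥ (λ l → A l j) ⟨
    ⊥ ∧ ⋁ⱽ (λ l → A l j)      ≈⟨ ∧-zeroˡ _ ⟩
    ⊥                         ∎
    where open SetoidReasoning setoid

  -- One closed-loop transition: applying control `κ` at a multiple of an open-loop state only
  -- replaces the scalar `β` by `κ ∧ β`.
  ·-∘-step : ∀ κ β (v w : Vector Carrier n) A → v ≋ β ·ⱽ w → κ ·ⱽ (v ∘ⱽ A) ≋ (κ ∧ β) ·ⱽ (w ∘ⱽ A)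
  ·-∘-step {n} κ β v w A v≋βw = begin
    κ ·ⱽ (v ∘ⱽ A)            ≈⟨ ·-congˡ κ (v ∘ⱽ A) ((β ·ⱽ w) ∘ⱽ A) (∘-congʳ v (β ·ⱽ w) A v≋βw) ⟩
    κ ·ⱽ ((β ·ⱽ w) ∘ⱽ A)     ≈⟨ ·-congˡ κ ((β ·ⱽ w) ∘ⱽ A) (β ·ⱽ (w ∘ⱽ A)) (·-∘-assoc β w A) ⟩
    κ ·ⱽ β ·ⱽ (w ∘ⱽ A)       ≈⟨ (λ i → ∧-assoc κ β ((w ∘ⱽ A) i)) ⟨
    (κ ∧ β) ·ⱽ (w ∘ⱽ A)      ∎
    where open SetoidReasoning (≋-setoid n)

  -- Used contrapositively: a vector with a nonzero multiple is itself nonzero, so the transition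
  -- leading to it is defined.
  multiple-of-𝟎 : ∀ α (p v : Vector Carrier n) → p ≋ α ·ⱽ v → v ≋ 𝟎 → p ≋ 𝟎
  multiple-of-𝟎 {n} α p v p≋αv v≋𝟎 = begin
    p         ≈⟨ p≋αv ⟩
    α ·ⱽ v    ≈⟨ ·-congˡ α v 𝟎 v≋𝟎 ⟩
    α ·ⱽ 𝟎    ≈⟨ (λ _ → ∧-zeroʳ α) ⟩
    𝟎         ∎
    where open SetoidReasoning (≋-setoid n)

open import Defs
open BoundedLattice unitInterval
  using (isPartialOrder; maximum; module Eq)
  renaming (setoid to 𝕀-setoid)
open ℝ
open VectorEquality 𝕀-setoid using (≋-trans; ≋-setoid)

-- The order compares lower cuts, on which `∧` and `∨` act as intersection and union.
𝕀-∧-distribˡ-∨ : ∀ x y z → x ∧ (y ∨ z) ≈ (x ∧ y) ∨ (x ∧ z)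
𝕀-∧-distribˡ-∨ _ _ _ =
  (λ { _ (a , inj₁ b) → inj₁ (a , b) ; _ (a , inj₂ c) → inj₂ (a , c) }) ,
  (λ { _ (inj₁ (a , b)) → a , inj₁ b ; _ (inj₂ (a , c)) → a , inj₂ c })

open VectorAlgebra unitInterval 𝕀-∧-distribˡ-∨
  using (·-congˡ; ·-congʳ; ·-identityˡ; ·-∘-step; ∘-preserves-𝟎; multiple-of-𝟎)

≈-refl : ∀ x → x ≈ x
≈-refl x = Eq.refl {x}

-- Runs of the closed loop compared with runs of the open loop.

module _ {n : ℕ} (G : FDES n) (Euc : FDES.Event G → 𝕀) where
  open FDES G

  -- Induction on the run. The last clause bounds `β` below by every lower bound of the degrees
  -- along `s`; `χ` enters later as one such bound.
  closedLoop-run : (f : FSFC G Euc) → ∀ {q p s} → Extend (closedLoop G f) q s p →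
    ∃[ r ] Extend (transition G) q s r ×
    ∃[ β ] vec p ≈ⱽ β · vec r × (∀ b → All (λ a → b ≤ Euc a) s → b ≤ β)
  closedLoop-run f {p = p} (empty q≈p) =
    p , empty q≈p ,
    𝟙 , (λ i → Eq.sym {𝟙 ∧ vec p i} {vec p i} (·-identityˡ (vec p) i)) , λ b _ → maximum b
  closedLoop-run f {p = p} (snoc {r = p′} {a = a} run p≈) with closedLoop-run f run
  ... | r , run′ , β , p′≈βr , β-greatest =
    (vec r ∘ A , (λ rA≈𝟘 → proj₂ p (multiple-of-𝟎 (κ ∧ β) (vec p) (vec r ∘ A) p≈κβrA rA≈𝟘))) ,
    snoc run′ (λ i → ≈-refl ((vec r ∘ A) i)) ,
    κ ∧ β , p≈κβrA ,
    λ b b≤ → let (b≤s , b≤a) = ∷ʳ⁻ b≤ in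
      λ q l → FSFC.admissible f p′ a q (b≤a q l) , β-greatest b b≤s q l
    where
    A = matrix a
    κ = FSFC.control f p′ a
    p≈κβrA : vec p ≈ⱽ (κ ∧ β) · (vec r ∘ A)
    p≈κβrA = ≋-trans {i = vec p} {j = κ · (vec p′ ∘ A)} {k = (κ ∧ β) · (vec r ∘ A)}
      p≈ (·-∘-step κ β (vec p′) (vec r) A p′≈βr)

  constantController : (k : Event → 𝕀) → (∀ a → Euc a ≤ k a) → FSFC G Euc
  constantController k Euc≤k = record
    { control    = λ _ → k
    ; cong       = λ _ a → ≈-refl (k a)
    ; admissible = λ _ → Euc≤k
    }

  -- The two clauses on `β` make it the meet of `k` along `s`. The closed-loop run is promised only
  -- to a state equal to `β · vec r`, because that vector may be zero.
  constantController-run : ∀ k (Euc≤k : ∀ a → Euc a ≤ k a) {q r s} → Extend (transition G) q s r →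
    ∃[ β ] All (λ a → β ≤ k a) s × (∀ b → All (λ a → b ≤ k a) s → b ≤ β) ×
           (∀ p → vec p ≈ⱽ β · vec r → Extend (closedLoop G (constantController k Euc≤k)) q s p)
  constantController-run k Euc≤k {q} {r} (empty q≈r) =
    𝟙 , [] , (λ b _ → maximum b) , λ p p≈𝟙r → empty (begin
      vec q      ≈⟨ q≈r ⟩
      vec r      ≈⟨ ·-identityˡ (vec r) ⟨
      𝟙 · vec r  ≈⟨ p≈𝟙r ⟨
      vec p      ∎)
    where open SetoidReasoning (≋-setoid n)
  constantController-run k Euc≤k {r = r} (snoc {r = r′} {a = a} run r≈r′A)
    with constantController-run k Euc≤k run
  ... | β , β≤s , β-greatest , close =
    k a ∧ β ,
    ∷ʳ⁺ (All.map (λ β≤ q (_ , l) → β≤ q l) β≤s) (λ _ → proj₁) ,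
    (λ b b≤ → let (b≤s , b≤a) = ∷ʳ⁻ b≤ in λ q l → b≤a q l , β-greatest b b≤s q l) ,
    -- The closed loop passes through `β · vec r′`, which is nonzero because the nonzero `p` is
    -- obtained from it by one transition.
    λ p p≈ → snoc (close (β · vec r′ , nonzero p p≈) (λ i → ≈-refl (β ∧ vec r′ i))) (step p p≈)
    where
    A = matrix a

    step : ∀ p → vec p ≈ⱽ (k a ∧ β) · vec r → vec p ≈ⱽ k a · ((β · vec r′) ∘ A)
    step p p≈ = begin
      vec p                       ≈⟨ p≈ ⟩
      (k a ∧ β) · vec r           ≈⟨ ·-congˡ (k a ∧ β) (vec r) (vec r′ ∘ A) r≈r′A ⟩
      (k a ∧ β) · (vec r′ ∘ A)    ≈⟨ ·-∘-step (k a) β (β · vec r′) (vec r′) A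
                                       (λ i → ≈-refl (β ∧ vec r′ i)) ⟨
      k a · ((β · vec r′) ∘ A)    ∎
      where open SetoidReasoning (≋-setoid n)

    nonzero : ∀ (p : State n) → vec p ≈ⱽ (k a ∧ β) · vec r → ¬ (β · vec r′ ≈ⱽ (λ _ → 𝟘))
    nonzero p p≈ βr′≈𝟘 = proj₂ p
      (multiple-of-𝟎 (k a) (vec p) ((β · vec r′) ∘ A) (step p p≈) (∘-preserves-𝟎 (β · vec r′) A βr′≈𝟘))

-- Classical order on the unit interval and attainment of the infimum.

module _ (em : ExcludedMiddle (suc 0ℓ)) where

  decide : (P : Set) → Dec P
  decide P = map′ lower lift (em {Lift (suc 0ℓ) P})

  -- If inclusion of lower cuts fails at some rational `q`, every rational in the cut of `υ` is at
  -- most `q`, hence in the cut of `ξ`.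
  ≤-total : Total _≤_
  ≤-total x@(ξ , _) y@(υ , _) with decide (∃[ q ] L ξ q × ¬ L υ q)
  ... | no none = inj₁ λ q l → decidable-stable (decide (L υ q)) λ ¬l → none (q , l , ¬l)
  ... | yes (q , l , ¬l) = inj₂ y≤x
    where
    y≤x : y ≤ x
    y≤x r l′ with ℚ.<-cmp r q
    ... | tri< r<q _ _  = L-lower ξ r<q l
    ... | tri≈ _ refl _ = l
    ... | tri> _ _ q<r  = contradiction (L-lower υ q<r l′) ¬l

  ≤-totalOrder : TotalOrder _ _ _
  ≤-totalOrder = record
    { isTotalOrder = record { isPartialOrder = isPartialOrder ; total = ≤-total } }

  open Extrema ≤-totalOrder using (min; min≤xs; v≤min⁺; argmin-sel)

  module _ {n : ℕ} (G : FDES n) (Euc : FDES.Event G → 𝕀) where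
    open FDES G

    -- Finitely many events and a total order turn the infimum into a minimum. Excluded middle
    -- selects the occurring events.
    χ-attained : ∀ q → ∃[ c ] c ∈ χ G Euc q ×
      (c ≡ 𝟙 ⊎ ∃[ a ] Occurs G Euc q a × c ≡ Euc a)
    χ-attained q = c , (lowerBound , greatest) , attained
      where
      occurs? : Decidable (Occurs G Euc q)
      occurs? a = em

      occurring : List Event
      occurring = filter occurs? (allFin size)

      c : 𝕀
      -- The seed `𝟙` is the infimum of the empty set and, being the top, changes no other minimum.
      c = min 𝟙 (map Euc occurring)

      degree-occurs : ∀ {x} → x ∈ˡ map Euc occurring → ∃[ a ] Occurs G Euc q a × x ≡ Euc a
      degree-occurs x∈ = let (a , a∈ , x≡) = ∈-map⁻ Euc x∈ in
        a , proj₂ (∈-filter⁻ occurs? {xs = allFin size} a∈) , x≡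

      lowerBound : ∀ x → (∃[ a ] Occurs G Euc q a × x ≈ Euc a) → c ≤ x
      lowerBound x (a , occ , _ , Euca≤x) r l = Euca≤x r
        (All.lookup (min≤xs 𝟙 (map Euc occurring))
          (∈-map⁺ Euc (∈-filter⁺ occurs? (∈-allFin a) occ)) r l)

      greatest : ∀ b → (∀ x → (∃[ a ] Occurs G Euc q a × x ≈ Euc a) → b ≤ x) → b ≤ c
      greatest b b≤ = v≤min⁺ {v = b} (maximum b) (All.tabulate λ {x} x∈ →
        let (a , occ , x≡) = degree-occurs x∈ in b≤ x (a , occ , Eq.reflexive x≡))

      attained : c ≡ 𝟙 ⊎ ∃[ a ] Occurs G Euc q a × c ≡ Euc a
      attained = Sum.map₂ degree-occurs (argmin-sel (λ x → x) 𝟙 (map Euc occurring))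

    -- The two inclusions.

    controlReachable⇒ℛ : ∀ {p} → p ∈ ControlReachable G Euc →
      p ∈ ⋃ (Σ[ q ∈ State n ] q ∈ Reachable G (transition G)) (λ (q , _) → ℛ G Euc q)
    controlReachable⇒ℛ (f , s , run) with closedLoop-run G Euc f run
    ... | r , run′ , β , p≈βr , β-greatest with χ-attained r
    ... | c , c∈χ@(lowerBound , _) , _ =
      (r , s , run′) , c , c∈χ , β , c≤β , maximum β , p≈βr
      where
      c≤β : c ≤ β
      -- The string `s` itself leads to `r` in the open loop, so each of its events enters the
      -- infimum `c`.
      c≤β = β-greatest c (All.tabulate λ {a} a∈s →
        lowerBound (Euc a) (a , (s , run′ , ∈-∃++ a∈s) , ≈-refl (Euc a)))

    ℛ⇒controlReachable : ∀ {p} →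
      p ∈ ⋃ (Σ[ q ∈ State n ] q ∈ Reachable G (transition G)) (λ (q , _) → ℛ G Euc q) →
      p ∈ ControlReachable G Euc
    ℛ⇒controlReachable {p} ((q , s , run) , c , (_ , c-greatest) , α , c≤α , _ , p≈αq)
      with χ-attained q
    ... | c′ , (c′-lowerBound , _) , attained = reach attained
      where
      k : Event → 𝕀
      k a = α ∨ Euc a

      reachBy : ∀ t → t ∈ S G Euc q → (∀ b → All (λ a → b ≤ k a) t → b ≤ α) →
                p ∈ ControlReachable G Euc
      reachBy t run-t ≤α with constantController-run G Euc k (λ _ _ → inj₂) run-t
      -- Since `α` lies below every `k a`, it is below the meet `β` along `t`; the assumption `≤α`
      -- gives the converse.
      ... | β , β≤t , β-greatest , close =
        constantController G Euc k (λ _ _ → inj₂) , t , close p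
          (≋-trans {i = vec p} {j = α · vec q} {k = β · vec q} p≈αq
            (·-congʳ α β (vec q) (β-greatest α (All.tabulate λ _ _ → inj₁) , ≤α β β≤t)))

      -- `c` is whichever representative of the infimum was supplied; the attained `c′` lies below
      -- it.
      c′≤α : c′ ≤ α
      c′≤α r l = c≤α r (c-greatest c′ c′-lowerBound r l)

      reach : c′ ≡ 𝟙 ⊎ ∃[ a ] Occurs G Euc q a × c′ ≡ Euc a → p ∈ ControlReachable G Euc
      -- Here `α` equals the top, so the given string already works.
      reach (inj₁ refl) = reachBy s run λ b _ r l → c′≤α r (maximum b r l)
      -- The string is replaced by one through an event `a` of degree `c′`; as `c′ ≤ α`, `k a` is
      -- `α`, which caps the meet.
      reach (inj₂ (a , (t , run-t , w , _ , refl) , refl)) = reachBy t run-t λ b b≤t r l →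
        [ (λ α∋r → α∋r) , c′≤α r ]′ (All.lookup b≤t (∈-insert w) r l)

proposition1 : ExcludedMiddle (suc 0ℓ) → (n : ℕ) → .{{_ : NonZero n}} → (G : FDES n) → (Euc : FDES.Event G → 𝕀) →
    ControlReachable G Euc ≐ ⋃ (Σ[ q ∈ State n ] q ∈ Reachable G (transition G)) (λ (q , _) → ℛ G Euc q)
proposition1 em n G Euc = controlReachable⇒ℛ em G Euc , ℛ⇒controlReachable em G Euc
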